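{- Let $\approx$ be any equivalence relation on Petri nets lying between branching ST-bisimilarity with explicit divergence and step readiness equivalence, i.e. such that for all Petri nets $N_1,N_2$: $N_1\approx^\Delta_{bSTb}N_2$ implies $N_1\approx N_2$, and $N_1\approx N_2$ implies $N_1\approx_{\mathscr R}N_2$. Let $N$ be a finitary plain structural conflict net. Then $N$ is distributable up to $\approx$ (i.e. there exists a distributed net $N'$ with $N'\approx N$) if and only if $N$ has no fully reachable pure $\mathsf{M}$.
   Context: **Petri nets.** Let $\mathrm{Act}$ be a set of visible actions, $\tau\notin\mathrm{Act}$ the invisible action, $\mathrm{Act}_\tau=\mathrm{Act}\cup\{\tau\}$. A multiset over $X$ is a function $A:X\to\mathbb N$; $\le,+,-$ are pointwise, $\cup$ is pointwise max, $\cap$ pointwise min, $x\in A$ iff $A(x)\neq 0$, $\varnothing$ is the zero multiset; $A$ is finite iff $\sum_x A(x)<\infty$. Sets are identified with $0/1$-valued multisets. A (labelled) Petri net is $N=(S,T,F,M_0,\ell)$ with $S,T$ disjoint sets (places, transitions), $F:(S\times T\cup T\times S)\to\mathbb N$, initial marking $M_0:S\to\mathbb N$, labelling $\ell:T\to\mathrm{Act}_\tau$. A marking is a multiset $M\in\mathbb N^S$. For $x\in S\cup T$ the multisets ${}^\bullet x,x^\bullet$ are ${}^\bullet x(y)=F(y,x)$, $x^\bullet(y)=F(x,y)$; they and $\ell$ extend additively to finite multisets $G$ of transitions (${}^\bullet G=\sum_t G(t)\cdot{}^\bullet t$, $\ell(G)=\sum_tG(t)\cdot\{\ell(t)\}$,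 etc.). For non-empty finite $G\in\mathbb N^T$, $M[G\rangle M'$ iff ${}^\bullet G\le M$ and $M'=(M-{}^\bullet G)+G^\bullet$; $M[G\rangle$ means $\exists M'.\,M[G\rangle M'$; $M[t\rangle M'$ abbreviates $M[\{t\}\rangle M'$. $[M_0\rangle$ is the set of reachable markings: the smallest set containing $M_0$ and closed under steps $[G\rangle$. $t\smile u$ iff $\exists M\in[M_0\rangle.\ M[\{t\}+\{u\}\rangle$ (also for $t=u$). **Classes of nets.** $N$ is a *structural conflict net* iff $t\smile u$ implies ${}^\bullet t\cap{}^\bullet u=\varnothing$. $N$ is *plain* iff $\ell$ is injective and no transition is labelled $\tau$. $N$ is *finitary* iff ${}^\bullet t\ne\varnothing$ for all $t\in T$, and every reachable marking is finite and enables only finitely many transitions. $N$ is *distributed* iff there is a function $D$ from $S\cup T$ to some set of locations such that (1) $s\in{}^\bullet t$ implies $D(t)=D(s)$ for $s\in S,t\in T$, and (2) $t\smile u$ implies $D(t)\neq D(u)$ for $t,u\in T$. $N$ has a *fully reachable pure $\mathsf M$* iff there are $t,u,v\in T$ with ${}^\bullet t\cap{}^\bullet u\ne\varnothing$, ${}^\bullet u\cap{}^\bullet v\neq\varnothing$, ${}^\bullet t\cap{}^\bullet v=\varnothing$ and some $M\in[M_0\rangle$ with ${}^\bullet t\cup{}^\bullet u\cup{}^\bullet v\le M$. **Step readiness equivalence.** $M\xrightarrow{\alpha}M'$ iff $M[t\rangle M'$ for some $t$ with $\ell(t)=\alpha\in\mathrm{Act}_\tau$; $\Longrightarrow$ is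 the reflexive transitive closure of $\xrightarrow{\tau}$; for $\sigma=a_1\cdots a_n\in\mathrm{Act}^*$, $M\stackrel{\sigma}{\Longrightarrow}M'$ iff $M\Longrightarrow\xrightarrow{a_1}\Longrightarrow\cdots\xrightarrow{a_n}\Longrightarrow M'$. For a non-empty finite $A\in\mathbb N^{\mathrm{Act}}$, $M\xrightarrow{A}$ iff there is a finite $G\in\mathbb N^T$ with $\ell(G)=A$ and $M[G\rangle$. $\langle\sigma,X\rangle$ is a step ready pair of $N$ iff there is $M$ with $M_0\stackrel{\sigma}{\Longrightarrow}M$, $M\not\xrightarrow{\tau}$ and $X=\{A\mid M\xrightarrow{A}\}$. $N_1\approx_{\mathscr R}N_2$ iff they have the same step ready pairs. **ST-LTS.** An ST-marking of $N$ is a pair $(M,U)\in\mathbb N^S\times T^*$; the initial one is $(M_0,\varepsilon)$. Transitions: $(M,U)\xrightarrow{a^+}(M',U')$ iff there is $t$ with $\ell(t)=a$, $M[t\rangle$, $M'=M-{}^\bullet t$, $U'=Ut$; $(M,U)\xrightarrow{a^{ -n}}(M',U')$ ($a\in\mathrm{Act}$, $n>0$) iff the $n$-th element $t$ of $U$ exists and has $\ell(t)=a$, $U'$ is $U$ with the $n$-th element removed, $M'=M+t^\bullet$; $(M,U)\xrightarrow{\tau}(M',U')$ iff $M\xrightarrow{\tau}M'$ and $U'=U$. The ST-LTS of $N$ has the ST-markings as states. **Branching bisimilarity with explicit divergence.** For labelled transition systems (LTSs), $p\xrightarrow{(\alpha)}p'$ means $p\xrightarrow{\alpha}p'$ or ($\alpha=\tau$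 and $p=p'$). A branching bisimulation between two LTSs is a relation $\mathcal B$ between their states such that initial states are related; if $p\,\mathcal B\,q$ and $p\xrightarrow{\alpha}p'$ then $q\Longrightarrow q^\dagger\xrightarrow{(\alpha)}q'$ for some $q^\dagger,q'$ with $p\,\mathcal B\,q^\dagger$, $p'\,\mathcal B\,q'$; and symmetrically. The LTSs are branching bisimilar with explicit divergence iff there is such a $\mathcal B$ satisfying moreover: if $p\,\mathcal B\,q$ and $p=p_0\xrightarrow{\tau}p_1\xrightarrow{\tau}\cdots$ is infinite with $p_k\,\mathcal B\,q$ for all $k$, then there is an infinite $q=q_0\xrightarrow{\tau}q_1\xrightarrow{\tau}\cdots$ with $p_k\,\mathcal B\,q_l$ for all $k,l$; and symmetrically. (When one of the LTSs has no infinite $\tau$-sequence from a reachable state, the extra condition amounts to the other having none either.) $N_1\approx^\Delta_{bSTb}N_2$ iff the ST-LTSs of $N_1,N_2$ are branching bisimilar with explicit divergence. -}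

module Defs where

open import Data.Fin.Base using (Fin; toℕ)
open import Data.List.Base
  using (List; []; _∷_; [_]; _∷ʳ_; length; lookup; map; removeAt; sum)
open import Data.List.Membership.Propositional using (_∈_)
open import Data.List.Relation.Binary.Permutation.Propositional using (_↭_)
open import Data.List.Relation.Unary.Unique.Propositional using (Unique)
open import Data.Maybe.Base using (Maybe; just; nothing)
open import Data.Nat.Base using (ℕ; suc; _+_; _∸_; _≤_; _⊓_; _⊔_)
open import Data.Product.Base using (Σ-syntax; ∃; ∃-syntax; _×_; _,_)
open import Data.Sum.Base using (_⊎_; inj₁; inj₂)
open import Function.Base using (flip)
open import Function.Bundles using (_⇔_)
open import Function.Definitions using (Injective)
open import Relation.Binary.Construct.Closure.ReflexiveTransitive using (Star)
open import Relation.Binary.Core using (REL; Rel)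
open import Relation.Binary.PropositionalEquality.Core using (_≡_; _≢_)
open import Relation.Binary.PropositionalEquality using (_≗_)
open import Relation.Nullary.Negation.Core using (¬_)
open import Relation.Unary using (Pred)
open import Level using (0ℓ)

-- Multisets are compared by pointwise equality _≗_ throughout, since function
-- extensionality is not available.  A finite multiset that has to be summed
-- over (a step, or the label of a step) is instead a list, taken up to _↭_.

Multiset : Set → Set
Multiset X = X → ℕ

module _ {X : Set} where

  infix  4 _≤ₘ_ _∈ₘ_
  infixl 6 _⊕_ _⊖_ _∪_ _∩_

  ∅ : Multiset X
  ∅ _ = 0

  _≤ₘ_ : Rel (Multiset X) 0ℓ
  A ≤ₘ B = ∀ x → A x ≤ B x

  _∈ₘ_ : X → Multiset X → Set
  x ∈ₘ A = A x ≢ 0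

  _⊕_ _⊖_ _∪_ _∩_ : Multiset X → Multiset X → Multiset X
  (A ⊕ B) x = A x + B x
  (A ⊖ B) x = A x ∸ B x
  (A ∪ B) x = A x ⊔ B x
  (A ∩ B) x = A x ⊓ B x

  -- Σₓ A(x) < ∞: the sums over finite subsets of X are bounded.
  FiniteMultiset : Multiset X → Set
  FiniteMultiset A = ∃[ b ] ∀ (xs : List X) → Unique xs → sum (map A xs) ≤ b

FiniteSet : {X : Set} → Pred X 0ℓ → Set
FiniteSet {X} P = Σ[ xs ∈ List X ] ∀ x → P x → x ∈ xs

-- Adjoins the invisible action to a set of visible ones.
infix 9 _+τ

_+τ : Set → Set
Act +τ = Maybe Act

pattern τ = nothing

------------------------------------------------------------------------
-- Labelled transition systems

record LTS (Act : Set) : Set₁ where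
  field
    State : Set
    init  : State
    step  : State → Act +τ → State → Set

module _ {Act : Set} (L : LTS Act) where
  open LTS L

  infix 4 _⟶⟨_⟩_ _⟶⟨⟨_⟩⟩_ _⟹_ _⟹⟨_⟩_

  _⟶⟨_⟩_ : State → Act +τ → State → Set
  _⟶⟨_⟩_ = step

  -- The optional transition p –(α)→ p′.
  _⟶⟨⟨_⟩⟩_ : State → Act +τ → State → Set
  p ⟶⟨⟨ α ⟩⟩ p′ = p ⟶⟨ α ⟩ p′ ⊎ (α ≡ τ × p ≡ p′)

  _⟹_ : Rel State 0ℓ
  _⟹_ = Star (λ p p′ → p ⟶⟨ τ ⟩ p′)

  _⟹⟨_⟩_ : State → List Act → State → Set
  p ⟹⟨ []    ⟩ p′ = p ⟹ p′
  p ⟹⟨ a ∷ σ ⟩ p′ =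
    ∃[ p₁ ] ∃[ p₂ ] p ⟹ p₁ × p₁ ⟶⟨ just a ⟩ p₂ × p₂ ⟹⟨ σ ⟩ p′

module _ {Act : Set} where
  open LTS

  Transfer : (P Q : LTS Act) → REL (State P) (State Q) 0ℓ → Set
  Transfer P Q B = ∀ {p q α p′} → B p q → step P p α p′ →
    ∃[ q† ] ∃[ q′ ]
      (_⟹_ Q q q† × _⟶⟨⟨_⟩⟩_ Q q† α q′ × B p q† × B p′ q′)

  DivergenceTransfer : (P Q : LTS Act) → REL (State P) (State Q) 0ℓ → Set
  DivergenceTransfer P Q B = ∀ {q} (p : ℕ → State P) →
    (∀ k → step P (p k) τ (p (suc k))) →
    (∀ k → B (p k) q) →
    Σ[ r ∈ (ℕ → State Q) ]
      (r 0 ≡ q × (∀ l → step Q (r l) τ (r (suc l))) × (∀ k l → B (p k) (r l)))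

  record IsBranchingBisimulation
    (P Q : LTS Act) (B : REL (State P) (State Q) 0ℓ) : Set where
    field
      initial  : B (init P) (init Q)
      forward  : Transfer P Q B
      backward : Transfer Q P (flip B)

  record IsBranchingBisimulationΔ
    (P Q : LTS Act) (B : REL (State P) (State Q) 0ℓ) : Set where
    field
      isBranchingBisimulation : IsBranchingBisimulation P Q B
      forward-divergence      : DivergenceTransfer P Q B
      backward-divergence     : DivergenceTransfer Q P (flip B)

  BranchingBisimilarΔ : LTS Act → LTS Act → Set₁
  BranchingBisimilarΔ P Q =
    Σ[ B ∈ REL (State P) (State Q) 0ℓ ] IsBranchingBisimulationΔ P Q B

------------------------------------------------------------------------
-- Petri nets

record PetriNet (Act : Set) : Set₁ where
  field
    S  : Set
    T  : Set
    F  : (S × T) ⊎ (T × S) → ℕ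
    M₀ : Multiset S
    ℓ  : T → Act +τ

  Marking : Set
  Marking = Multiset S

  infix 9 •_ _•

  •_ : T → Marking
  (• t) s = F (inj₁ (s , t))

  _• : T → Marking
  (t •) s = F (inj₂ (t , s))

  pre post : List T → Marking
  pre  G s = sum (map (λ t → (• t) s) G)
  post G s = sum (map (λ t → (t •) s) G)

  infix 4 _[_⟩_ _[_⟩

  _[_⟩_ : Marking → List T → Marking → Set
  M [ G ⟩ M′ = G ≢ [] × pre G ≤ₘ M × M′ ≗ (M ⊖ pre G) ⊕ post G

  _[_⟩ : Marking → List T → Set
  M [ G ⟩ = ∃[ M′ ] M [ G ⟩ M′

  data Reachable : Marking → Set where
    start : ∀ {M} → M ≗ M₀ → Reachable M
    fire  : ∀ {M G M′} → Reachable M → M [ G ⟩ M′ → Reachable M′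

  infix 4 _⌣_

  _⌣_ : Rel T 0ℓ
  t ⌣ u = ∃[ M ] (Reachable M × M [ t ∷ u ∷ [] ⟩)

module _ {Act : Set} (N : PetriNet Act) where
  open PetriNet N

  IsStructuralConflictNet : Set
  IsStructuralConflictNet = ∀ t u → t ⌣ u → • t ∩ • u ≗ ∅

  IsPlain : Set
  IsPlain = Injective _≡_ _≡_ ℓ × (∀ t → ℓ t ≢ τ)

  record IsFinitary : Set where
    field
      nonempty-preset : ∀ t → ¬ (• t ≗ ∅)
      finite-marking  : ∀ {M} → Reachable M → FiniteMultiset M
      finite-enabled  : ∀ {M} → Reachable M → FiniteSet (λ t → M [ [ t ] ⟩)

  record IsDistributed : Set₁ where
    field
      Location    : Set
      D           : S ⊎ T → Location
      co-located  : ∀ s t → s ∈ₘ • t → D (inj₂ t) ≡ D (inj₁ s)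
      distributed : ∀ t u → t ⌣ u → D (inj₂ t) ≢ D (inj₂ u)

  HasFullyReachablePureM : Set
  HasFullyReachablePureM = ∃[ t ] ∃[ u ] ∃[ v ]
    ( ¬ (• t ∩ • u ≗ ∅) × ¬ (• u ∩ • v ≗ ∅) × • t ∩ • v ≗ ∅
    × ∃[ M ] (Reachable M × • t ∪ • u ∪ • v ≤ₘ M))

------------------------------------------------------------------------
-- Step readiness equivalence

  markingLTS : LTS Act
  markingLTS = record
    { State = Marking
    ; init  = M₀
    ; step  = λ M α M′ → ∃[ t ] (ℓ t ≡ α × M [ [ t ] ⟩ M′)
    }

  _–[_]→ : Marking → List Act → Set
  M –[ A ]→ = ∃[ G ] (map ℓ G ↭ map just A × M [ G ⟩)

  -- X is a set of finite multisets over Act, given as a predicate on lists.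
  -- The last conjunct makes it closed under _↭_ and free of the empty list.
  StepReadyPair : List Act → Pred (List Act) 0ℓ → Set
  StepReadyPair σ X = ∃[ M ]
    ( _⟹⟨_⟩_ markingLTS M₀ σ M
    × ¬ (∃[ M′ ] _⟶⟨_⟩_ markingLTS M τ M′)
    × (∀ A → X A ⇔ M –[ A ]→))

infix 4 _≈ᴿ_ _≈ᵇˢᵀᵇΔ_

_≈ᴿ_ : {Act : Set} → Rel (PetriNet Act) _
N₁ ≈ᴿ N₂ = ∀ σ X → StepReadyPair N₁ σ X ⇔ StepReadyPair N₂ σ X

------------------------------------------------------------------------
-- Branching ST-bisimilarity with explicit divergence

infix 9 _⁺ _⁻_

-- a ⁻ n ends the n-th running transition, counting from 1; no transition of
-- an ST-LTS carries a label a ⁻ 0.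
data STAct (Act : Set) : Set where
  _⁺  : Act → STAct Act
  _⁻_ : Act → ℕ → STAct Act

module _ {Act : Set} (N : PetriNet Act) where
  open PetriNet N

  STMarking : Set
  STMarking = Marking × List T

  STStep : STMarking → STAct Act +τ → STMarking → Set
  STStep (M , U) (just (a ⁺)) (M′ , U′) =
    ∃[ t ] (ℓ t ≡ just a × M [ [ t ] ⟩ × M′ ≗ M ⊖ • t × U′ ≡ U ∷ʳ t)
  STStep (M , U) (just (a ⁻ n)) (M′ , U′) =
    Σ[ i ∈ Fin (length U) ]
      ( suc (toℕ i) ≡ n × ℓ (lookup U i) ≡ just a
      × U′ ≡ removeAt U i × M′ ≗ M ⊕ (lookup U i) •)
  STStep (M , U) τ (M′ , U′) =
    _⟶⟨_⟩_ (markingLTS N) M τ M′ × U′ ≡ U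

  ST-LTS : LTS (STAct Act)
  ST-LTS = record
    { State = STMarking
    ; init  = M₀ , []
    ; step  = STStep
    }

_≈ᵇˢᵀᵇΔ_ : {Act : Set} → Rel (PetriNet Act) _
N₁ ≈ᵇˢᵀᵇΔ N₂ = BranchingBisimilarΔ (ST-LTS N₁) (ST-LTS N₂)

DistributableUpTo : ∀ {Act : Set} {r} → Rel (PetriNet Act) r →
                    PetriNet Act → Set _
DistributableUpTo _≈_ N = ∃[ N′ ] (IsDistributed N′ × N′ ≈ N)

{-# OPTIONS --safe #-}
-- Only if: step readiness lets a distributed net imitate the marking that shows
-- the pure M t, u, v.  Each of its counterparts of t and v competes with that of
-- u, hence shares u's location, although those of t and v can fire together.
--
-- If: without a reachable pure M, conflict is an equivalence on the transitions
-- enabled at a reachable marking.  Firing a transition disables precisely its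
-- own class, and until then the class can only grow.  So the net is implemented
-- by one sequential coordinator that logs finished transitions, together with
-- one location for each class that ever arises.  At that location a single lock
-- guards the firing, and the coordinator adds an offer for each enabled member.
-- Visible transitions fire at their class; only the logging is silent.  It is
-- inert, and it terminates because every firing is logged once.
module Submission where

open import Defs
open import Axiom.ExcludedMiddle using (ExcludedMiddle)
open import Data.Empty using (⊥)
open import Data.Fin.Base using (Fin; zero; suc; toℕ)
open import Data.List.Base
  using (List; []; _∷_; [_]; _∷ʳ_; _++_; filter; length; lookup; map; removeAt)
open import Data.List.Membership.Propositional using (_∈_; _∉_)
open import Data.List.Membership.Propositional.Properties
  using (∈-filter⁺; ∈-filter⁻; ∈-map⁺; ∈-map⁻; ∈-∃++; ∈-++⁺ˡ)
open import Data.List.Properties using (++-assoc; filter-≐; map-++)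
open import Data.List.Relation.Binary.Permutation.Propositional
  using (_↭_; ↭-refl; ↭-sym; ↭-trans; ↭⇒↭ₛ; prep; swap)
open import Data.List.Relation.Binary.Permutation.Propositional.Properties
  using (map⁺; ↭-map-inv; All-resp-↭; ∈-resp-↭; shift; ++⁺ʳ; ++⁺ˡ; ↭-length; ∷↭∷ʳ)
import Data.List.Relation.Binary.Permutation.Setoid.Properties as Permutationₛ
open import Data.List.Relation.Unary.All as All using (All; []; _∷_)
open import Data.List.Relation.Unary.AllPairs as AllPairs using ([]; _∷_)
open import Data.List.Relation.Unary.Any using (here; there)
open import Data.List.Relation.Unary.Unique.Propositional using (Unique)
open import Data.Maybe.Base using (Maybe; just)
open import Data.Nat.Base using (ℕ; zero; suc; _+_; _∸_; _⊓_; _≤_; _<_; z≤n)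
open import Data.Nat.ListAction.Properties using (sum-↭)
open import Data.Nat.Properties
open import Data.Product.Base using (∃-syntax; _×_; _,_; proj₁; proj₂; uncurry; map₂)
open import Data.Sum.Base using (_⊎_; inj₁; inj₂; [_,_]′)
open import Function.Base using (_∘_; flip; id)
open import Function.Bundles using (_⇔_; mk⇔; Equivalence)
open import Level using (Level; 0ℓ)
open import Relation.Binary.Construct.Closure.ReflexiveTransitive using (ε; _◅_)
open import Relation.Binary.Core using (Rel)
open import Relation.Binary.PropositionalEquality
  using (_≡_; _≢_; _≗_; refl; sym; trans; cong; cong₂; subst; setoid; module ≡-Reasoning)
open import Relation.Binary.Structures using (IsEquivalence)
open import Relation.Nullary.Decidable.Core using (Dec; yes; no; decidable-stable)
open import Relation.Nullary.Negation.Core using (¬_; contradiction)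

-- Firing, reachability and traces in one net.

m⊓n≡0⇒m≡0⊎n≡0 : ∀ {m n} → m ⊓ n ≡ 0 → m ≡ 0 ⊎ n ≡ 0
m⊓n≡0⇒m≡0⊎n≡0 {zero} _ = inj₁ refl
m⊓n≡0⇒m≡0⊎n≡0 {suc _} {zero} _ = inj₂ refl

module Net {Act : Set} (N : PetriNet Act) where
  open PetriNet N

  infixl 6 _▷_
  _▷_ : Marking → T → Marking
  M ▷ t = (M ⊖ • t) ⊕ t •

  pre-[] : ∀ t → pre [ t ] ≗ • t
  pre-[] t s = +-identityʳ ((• t) s)

  fire-single : ∀ {M} t {M′} → • t ≤ₘ M → M′ ≗ M ▷ t → M [ [ t ] ⟩ M′
  fire-single {M} t •t≤M M′≗ =
    (λ ()) ,
    (λ s → ≤-trans (≤-reflexive (pre-[] t s)) (•t≤M s)) ,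
    (λ s → trans (M′≗ s) (cong₂ (λ p q → M s ∸ p + q)
      (sym (pre-[] t s)) (sym (+-identityʳ ((t •) s)))))

  single-pre : ∀ {M t M′} → M [ [ t ] ⟩ M′ → • t ≤ₘ M
  single-pre {t = t} (_ , p , _) s = ≤-trans (≤-reflexive (sym (pre-[] t s))) (p s)

  single-post : ∀ {M t M′} → M [ [ t ] ⟩ M′ → M′ ≗ M ▷ t
  single-post {M} {t} (_ , _ , e) s =
    trans (e s) (cong₂ (λ p q → M s ∸ p + q) (pre-[] t s) (+-identityʳ ((t •) s)))

  enables : ∀ {M} G → G ≢ [] → pre G ≤ₘ M → M [ G ⟩
  enables G G≢[] p = _ , G≢[] , p , λ _ → refl

  pair-enabled : ∀ {M t u} → (∀ s → (• t) s + (• u) s ≤ M s) → M [ t ∷ u ∷ [] ⟩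
  pair-enabled {u = u} p =
    enables _ (λ ()) λ s → ≤-trans (+-monoʳ-≤ _ (≤-reflexive (pre-[] u s))) (p s)

  pair-pre : ∀ {M t u} → M [ t ∷ u ∷ [] ⟩ → ∀ s → (• t) s + (• u) s ≤ M s
  pair-pre {u = u} (_ , _ , p , _) s =
    ≤-trans (+-monoʳ-≤ _ (≤-reflexive (sym (pre-[] u s)))) (p s)

  pre-↭ : ∀ {G H} → G ↭ H → ∀ s → pre G s ≡ pre H s
  pre-↭ G↭H s = sum-↭ (map⁺ _ G↭H)

  post-↭ : ∀ {G H} → G ↭ H → ∀ s → post G s ≡ post H s
  post-↭ G↭H s = sum-↭ (map⁺ _ G↭H)

  -- A step can be serialised: once its first transition has fired, the others are still enabled. So
  -- single firings are all that an invariant has to survive.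
  module Invariant {c} (I : Marking → Set c)
    (resp : ∀ {M M′} → M ≗ M′ → I M → I M′)
    (step : ∀ {M} t → • t ≤ₘ M → I M → I (M ▷ t)) where

    steps : ∀ {M} G → pre G ≤ₘ M → I M → I ((M ⊖ pre G) ⊕ post G)
    steps [] _ = resp λ _ → sym (+-identityʳ _)
    steps {M} (t ∷ G) p i = resp regroup (steps G later (step t now i))
      where
      now : • t ≤ₘ M
      now s = ≤-trans (m≤m+n _ _) (p s)
      rest : ∀ s → pre G s ≤ M s ∸ (• t) s
      rest s = m+n≤o⇒n≤o∸m _ (p s)
        where
        m+n≤o⇒n≤o∸m : ∀ m {n o} → m + n ≤ o → n ≤ o ∸ m
        m+n≤o⇒n≤o∸m m {n} {o} q = m+n≤o⇒m≤o∸n n (subst (_≤ o) (+-comm m n) q)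
      later : pre G ≤ₘ M ▷ t
      later s = ≤-trans (rest s) (m≤m+n _ _)
      regroup : (M ▷ t ⊖ pre G) ⊕ post G ≗ (M ⊖ pre (t ∷ G)) ⊕ post (t ∷ G)
      regroup s = begin
        M s ∸ a + b ∸ c′ + d     ≡⟨ cong (_+ d) (+-∸-comm b (rest s)) ⟩
        (M s ∸ a ∸ c′ + b) + d   ≡⟨ +-assoc (M s ∸ a ∸ c′) b d ⟩
        M s ∸ a ∸ c′ + (b + d)   ≡⟨ cong (_+ (b + d)) (∸-+-assoc (M s) a c′) ⟩
        M s ∸ (a + c′) + (b + d) ∎
        where
        open ≡-Reasoning
        a b c′ d : ℕ
        a = (• t) s
        b = (t •) s
        c′ = pre G s
        d = post G s

    reachable : I M₀ → ∀ {M} → Reachable M → I M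
    reachable i (start e) = resp (λ s → sym (e s)) i
    reachable i (fire {G = G} r (_ , p , e)) =
      resp (λ s → sym (e s)) (steps G p (reachable i r))

  ⟹-reachable : ∀ {M M′} → Reachable M → _⟹_ (markingLTS N) M M′ → Reachable M′
  ⟹-reachable r ε = r
  ⟹-reachable r ((_ , _ , f) ◅ xs) = ⟹-reachable (fire r f) xs

  ⟹⟨⟩-reachable : ∀ {M M′} σ → Reachable M → _⟹⟨_⟩_ (markingLTS N) M σ M′ → Reachable M′
  ⟹⟨⟩-reachable [] r xs = ⟹-reachable r xs
  ⟹⟨⟩-reachable (a ∷ σ) r (_ , _ , xs , (_ , _ , f) , ys) =
    ⟹⟨⟩-reachable σ (fire (⟹-reachable r xs) f) ys

  ⟹⟨⟩-snoc : ∀ {M M′ M″ a} σ → _⟹⟨_⟩_ (markingLTS N) M σ M′ →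
    _⟶⟨_⟩_ (markingLTS N) M′ (just a) M″ → _⟹⟨_⟩_ (markingLTS N) M (σ ++ [ a ]) M″
  ⟹⟨⟩-snoc [] xs f = _ , _ , xs , f , ε
  ⟹⟨⟩-snoc (_ ∷ σ) (_ , _ , xs , f , ys) g = _ , _ , xs , f , ⟹⟨⟩-snoc σ ys g

  -- A trace can only reach markings up to _≗_, since an empty trace stays put.
  HasTrace : Marking → Set
  HasTrace M = ∃[ σ ] ∃[ M̂ ] _⟹⟨_⟩_ (markingLTS N) M₀ σ M̂ × M̂ ≗ M

  -- Step readiness only sees markings reached along traces. Since every transition is visible,
  -- serialising the steps and recording the labels gives such a trace.
  reachable⇒trace : (∀ t → ℓ t ≢ τ) → ∀ {M} → Reachable M → HasTrace M
  reachable⇒trace visible = Invariant.reachable HasTrace resp step ([] , _ , ε , λ _ → refl)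
    where
    resp : ∀ {M M′} → M ≗ M′ → HasTrace M → HasTrace M′
    resp e (σ , M̂ , tr , ê) = σ , M̂ , tr , λ s → trans (ê s) (e s)
    step : ∀ {M} t → • t ≤ₘ M → HasTrace M → HasTrace (M ▷ t)
    step t p (σ , M̂ , tr , ê) with ℓ t in eq
    ... | just a = σ ++ [ a ] , M̂ ▷ t ,
      ⟹⟨⟩-snoc σ tr (t , eq ,
        fire-single t (λ s → ≤-trans (p s) (≤-reflexive (sym (ê s)))) λ _ → refl) ,
      λ s → cong (λ m → m ∸ (• t) s + (t •) s) (ê s)
    ... | τ = contradiction eq (visible t)

  private
    pair-images : ∀ {G α β} → map ℓ G ↭ α ∷ β ∷ [] →
      ∃[ t ] ∃[ u ] (ℓ t ≡ α × ℓ u ≡ β × G ↭ t ∷ u ∷ [])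
    pair-images p with ↭-map-inv ℓ p
    ... | t ∷ u ∷ [] , refl , q = t , u , refl , refl , q

    single-image : ∀ {G α} → map ℓ G ↭ α ∷ [] → ∃[ t ] (ℓ t ≡ α × G ↭ t ∷ [])
    single-image p with ↭-map-inv ℓ p
    ... | t ∷ [] , refl , q = t , refl , q

  ready-pair : ∀ {M a b} → _–[_]→ N M (a ∷ b ∷ []) →
    ∃[ t ] ∃[ u ] (ℓ t ≡ just a × ℓ u ≡ just b × M [ t ∷ u ∷ [] ⟩)
  ready-pair (G , p , _ , _ , q , _) with pair-images p
  ... | t , u , et , eu , r = t , u , et , eu ,
    enables _ (λ ()) λ s → ≤-trans (≤-reflexive (sym (pre-↭ r s))) (q s)

  pair-ready : ∀ {M t u a b} → ℓ t ≡ just a → ℓ u ≡ just b → M [ t ∷ u ∷ [] ⟩ →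
    _–[_]→ N M (a ∷ b ∷ [])
  pair-ready {t = t} {u} et eu f = t ∷ u ∷ [] ,
    subst (map ℓ (t ∷ u ∷ []) ↭_) (cong₂ (λ α β → α ∷ β ∷ []) et eu) ↭-refl , f

  ready-single : ∀ {M a} → _–[_]→ N M [ a ] → ∃[ t ] (ℓ t ≡ just a × • t ≤ₘ M)
  ready-single (G , p , _ , _ , q , _) with single-image p
  ... | t , et , r = t , et , λ s →
    ≤-trans (≤-reflexive (trans (sym (pre-[] t s)) (sym (pre-↭ r s)))) (q s)

  single-ready : ∀ {M t a} → ℓ t ≡ just a → • t ≤ₘ M → _–[_]→ N M [ a ]
  single-ready {t = t} et p = [ t ] , subst (λ α → [ ℓ t ] ↭ [ α ]) et ↭-refl ,
    _ , fire-single t p λ _ → refl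

  disjoint⇒pair-enabled : ∀ {M t u} → • t ∩ • u ≗ ∅ → • t ≤ₘ M → • u ≤ₘ M → M [ t ∷ u ∷ [] ⟩
  disjoint⇒pair-enabled {t = t} {u} d p q = pair-enabled λ s → sum≤ s (m⊓n≡0⇒m≡0⊎n≡0 (d s))
    where
    sum≤ : ∀ s → (• t) s ≡ 0 ⊎ (• u) s ≡ 0 → (• t) s + (• u) s ≤ _
    sum≤ s (inj₁ e) rewrite e = q s
    sum≤ s (inj₂ e) rewrite e | +-identityʳ ((• t) s) = p s

-- Competition in distributed nets and the pure M.

module _ (em : ExcludedMiddle 0ℓ) {Act : Set} (N : PetriNet Act) (dist : IsDistributed N) where

  open PetriNet N
  open IsDistributed dist

  -- A pre-place lies at the location of its transition. So transitions at different locations share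
  -- no pre-place, and then `M` covers both presets at once.
  competing⇒co-located : ∀ {M t u} → • t ≤ₘ M → • u ≤ₘ M → ¬ (M [ t ∷ u ∷ [] ⟩) →
    D (inj₂ t) ≡ D (inj₂ u)
  competing⇒co-located {M} {t} {u} p q competing =
    decidable-stable em λ apart → competing (Net.pair-enabled N (sum≤ apart))
    where
    sum≤ : D (inj₂ t) ≢ D (inj₂ u) → ∀ s → (• t) s + (• u) s ≤ M s
    sum≤ apart s with (• t) s in et | (• u) s in eu
    ... | zero  | m = subst (_≤ M s) eu (q s)
    ... | suc n | zero = subst (_≤ M s) (trans et (sym (+-identityʳ _))) (p s)
    ... | suc n | suc m = contradiction
      (trans (co-located s t (λ e → 1+n≢0 (trans (sym et) e)))
        (sym (co-located s u (λ e → 1+n≢0 (trans (sym eu) e))))) apart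

module _ (em : ExcludedMiddle 0ℓ) {Act : Set} where

  -- With labels `a`, `b`, `c` for `t`, `u`, `v`, the ready set at `M̂` contains `a ∷ c ∷ []` and
  -- `[ b ]`, but neither `a ∷ b ∷ []` nor `b ∷ c ∷ []`. No marking reachable in a distributed net
  -- shows this pattern.
  distributable⇒no-M : ∀ (N N′ : PetriNet Act) → IsDistributed N′ → N′ ≈ᴿ N →
    IsPlain N → IsStructuralConflictNet N → ¬ HasFullyReachablePureM N
  distributable⇒no-M N N′ dist N′≈N (injective , visible) scn
    (t , u , v , t#u , u#v , t∩v , M , reach , ≤M)
    with Net.reachable⇒trace N visible reach
  ... | σ , M̂ , tr , ê = impossible _ _ _ refl refl refl
    where
    open PetriNet N
    module N = Net N
    module N′ = Net N′

    ≤M̂ : • t ∪ • u ∪ • v ≤ₘ M̂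
    ≤M̂ s = ≤-trans (≤M s) (≤-reflexive (sym (ê s)))

    X : List Act → Set
    X A = _–[_]→ N M̂ A

    ready : StepReadyPair N σ X
    ready = M̂ , tr , (λ (_ , w , e , _) → visible w e) , λ _ → mk⇔ id id

    -- Labels are injective, so the step found consists of `w` and `x` themselves, which a
    -- structural conflict net never fires together when their presets meet.
    conflict : ∀ {w x a b} → ¬ (• w ∩ • x ≗ ∅) → ℓ w ≡ just a → ℓ x ≡ just b → ¬ X (a ∷ b ∷ [])
    conflict w#x ew ex r with N.ready-pair r
    ... | w′ , x′ , ew′ , ex′ , f
      rewrite injective (trans ew (sym ew′)) | injective (trans ex (sym ex′)) =
      w#x (scn _ _ (M̂ , N.⟹⟨⟩-reachable σ (start λ _ → refl) tr , f))

    impossible : ∀ α β γ → ℓ t ≡ α → ℓ u ≡ β → ℓ v ≡ γ → _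
    impossible τ _ _ et _ _ = visible t et
    impossible _ τ _ _ eu _ = visible u eu
    impossible _ _ τ _ _ ev = visible v ev
    impossible (just a) (just b) (just c) et eu ev
      with Equivalence.from (N′≈N σ X) ready
    ... | M′ , tr′ , _ , same
      -- `N′` may have several transitions per label. Any choice will do, since the excluded label
      -- pairs rule out firing `u′` together with `t′` or `v′`.
      with N′.ready-pair (Equivalence.to (same (a ∷ c ∷ []))
             (N.pair-ready et ev (N.disjoint⇒pair-enabled t∩v
               (λ s → ≤-trans (m≤m⊔n _ _) (≤-trans (m≤m⊔n _ _) (≤M̂ s)))
               (λ s → ≤-trans (m≤n⊔m _ _) (≤M̂ s)))))
         | N′.ready-single (Equivalence.to (same [ b ])
             (N.single-ready eu λ s → ≤-trans (m≤n⊔m ((• t) s) _) (≤-trans (m≤m⊔n _ _) (≤M̂ s))))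
    ... | t′ , v′ , et′ , ev′ , f | u′ , eu′ , q =
      IsDistributed.distributed dist t′ v′ (M′ , N′.⟹⟨⟩-reachable σ (PetriNet.start λ _ → refl) tr′ , f)
        (trans (competing⇒co-located em N′ dist
                  (λ s → ≤-trans (m≤m+n _ _) (N′.pair-pre f s)) q
                  (λ g → conflict t#u et eu (Equivalence.from (same _) (N′.pair-ready et′ eu′ g))))
               (competing⇒co-located em N′ dist q
                  (λ s → ≤-trans (m≤n+m _ _) (N′.pair-pre f s))
                  (λ g → conflict u#v eu ev (Equivalence.from (same _) (N′.pair-ready eu′ ev′ g)))))

-- Arithmetic, permutations and positions in lists.

fire-balance : ∀ {x b a c p q} → x + (b + p) ≡ a + (c + q) → b ≤ a → x + p ≡ (a ∸ b + c) + q
fire-balance {x} {b} {a} {c} {p} {q} e b≤a = +-cancelˡ-≡ b _ _ (begin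
  b + (x + p)             ≡⟨ +-assoc b x p ⟨
  b + x + p               ≡⟨ cong (_+ p) (+-comm b x) ⟩
  x + b + p               ≡⟨ +-assoc x b p ⟩
  x + (b + p)             ≡⟨ e ⟩
  a + (c + q)             ≡⟨ cong (_+ (c + q)) (m+[n∸m]≡n b≤a) ⟨
  b + (a ∸ b) + (c + q)   ≡⟨ +-assoc b (a ∸ b) (c + q) ⟩
  b + (a ∸ b + (c + q))   ≡⟨ cong (b +_) (+-assoc (a ∸ b) c q) ⟨
  b + (a ∸ b + c + q)     ∎)
  where
  open ≡-Reasoning

Unique-resp-↭ : ∀ {A : Set} {xs ys : List A} → xs ↭ ys → Unique xs → Unique ys
Unique-resp-↭ p = Permutationₛ.Unique-resp-↭ (setoid _) (↭⇒↭ₛ p)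

∷ʳ↭∷ : ∀ {A : Set} (xs : List A) {ys x} → xs ++ (ys ∷ʳ x) ↭ x ∷ xs ++ ys
∷ʳ↭∷ xs {ys} {x} =
  subst (_↭ x ∷ xs ++ ys) (++-assoc xs ys [ x ]) (↭-sym (∷↭∷ʳ x (xs ++ ys)))

∈⇒↭ : ∀ {A : Set} {x : A} {xs} → x ∈ xs → ∃[ ys ] xs ↭ x ∷ ys
∈⇒↭ x∈xs with ys , zs , refl ← ∈-∃++ x∈xs = ys ++ zs , shift _ ys zs

removeAt-↭ : ∀ {A : Set} (xs : List A) k → xs ↭ lookup xs k ∷ removeAt xs k
removeAt-↭ (x ∷ xs) zero    = ↭-refl
removeAt-↭ (x ∷ xs) (suc k) = ↭-trans (prep x (removeAt-↭ xs k)) (swap x (lookup xs k) ↭-refl)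

module _ {A B : Set} (f : A → B) where

  -- A label `a ⁻ n` picks a running transition by position. The thread lists of both nets will be
  -- images of one list of entries, so positions must be carried across `map` in both directions.
  SamePosition : ∀ xs → Fin (length (map f xs)) → Fin (length xs) → Set
  SamePosition xs i k =
    toℕ i ≡ toℕ k × lookup (map f xs) i ≡ f (lookup xs k) ×
    removeAt (map f xs) i ≡ map f (removeAt xs k)

  position-map⁻ : ∀ xs i → ∃[ k ] SamePosition xs i k
  position-map⁻ (x ∷ xs) zero = zero , refl , refl , refl
  position-map⁻ (x ∷ xs) (suc i) with k , p , q , r ← position-map⁻ xs i =
    suc k , cong suc p , q , cong (f x ∷_) r

  position-map⁺ : ∀ xs k → ∃[ i ] SamePosition xs i k
  position-map⁺ (x ∷ xs) zero = zero , refl , refl , refl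
  position-map⁺ (x ∷ xs) (suc k) with i , p , q , r ← position-map⁺ xs k =
    suc i , cong suc p , q , cong (f x ∷_) r

-- Propositions as token counts.

module Indicator (em : ExcludedMiddle 0ℓ) where

  private
    indicator : {P : Set} → Dec P → ℕ
    indicator (yes _) = 1
    indicator (no _)  = 0

  -- The arc weights and the initial marking of the implementation are 0/1-valued. Excluded middle
  -- lets them be given by relations, and the token game becomes reasoning about propositions.
  ⟦_⟧ : Set → ℕ
  ⟦ P ⟧ = indicator (em {P})

  private variable P Q R : Set

  ⟦⟧≤1 : ⟦ P ⟧ ≤ 1
  ⟦⟧≤1 {P} with em {P}
  ... | yes _ = ≤-refl
  ... | no _  = z≤n

  ⟦⟧-yes : P → ⟦ P ⟧ ≡ 1
  ⟦⟧-yes {P} p with em {P}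
  ... | yes _ = refl
  ... | no ¬p = contradiction p ¬p

  ⟦⟧-no : ¬ P → ⟦ P ⟧ ≡ 0
  ⟦⟧-no {P} ¬p with em {P}
  ... | yes p = contradiction p ¬p
  ... | no _  = refl

  ⟦⟧-witness : 1 ≤ ⟦ P ⟧ → P
  ⟦⟧-witness {P} q with em {P}
  ⟦⟧-witness q  | yes p = p
  ⟦⟧-witness () | no _

  ⟦⟧-cong : (P → Q) → (Q → P) → ⟦ P ⟧ ≡ ⟦ Q ⟧
  ⟦⟧-cong {P} {Q} f g with em {P}
  ... | yes p = sym (⟦⟧-yes (f p))
  ... | no ¬p = sym (⟦⟧-no (¬p ∘ g))

  ⟦⟧-+ : ¬ (P × Q) → (R → P ⊎ Q) → (P ⊎ Q → R) → ⟦ P ⟧ + ⟦ Q ⟧ ≡ ⟦ R ⟧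
  ⟦⟧-+ {P} {Q} disjoint f g with em {P} | em {Q}
  ... | yes p | yes q = contradiction (p , q) disjoint
  ... | yes p | no _  = sym (⟦⟧-yes (g (inj₁ p)))
  ... | no _  | yes q = sym (⟦⟧-yes (g (inj₂ q)))
  ... | no ¬p | no ¬q = sym (⟦⟧-no ([ ¬p , ¬q ]′ ∘ f))

  ⟦⟧-∸ : (R → P × ¬ Q) → (P → ¬ Q → R) → ⟦ P ⟧ ∸ ⟦ Q ⟧ ≡ ⟦ R ⟧
  ⟦⟧-∸ {R} {P} {Q} f g with em {P} | em {Q}
  ... | yes p | yes q = sym (⟦⟧-no (λ r → proj₂ (f r) q))
  ... | yes p | no ¬q = sym (⟦⟧-yes (g p ¬q))
  ... | no ¬p | yes q = sym (⟦⟧-no (¬p ∘ proj₁ ∘ f))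
  ... | no ¬p | no ¬q = sym (⟦⟧-no (¬p ∘ proj₁ ∘ f))

-- Conflict clusters and their names.

module Clusters (em : ExcludedMiddle 0ℓ) {Act : Set} (N : PetriNet Act)
  (finitary : IsFinitary N) (scn : IsStructuralConflictNet N)
  (noM : ¬ HasFullyReachablePureM N) where

  open PetriNet N
  open Net N
  open IsFinitary finitary

  infix 4 _#_
  _#_ : T → T → Set
  t # u = ¬ (• t ∩ • u ≗ ∅)

  #-refl : ∀ t → t # t
  #-refl t e = nonempty-preset t λ s → trans (sym (⊓-idem _)) (e s)

  #-sym : ∀ {t u} → t # u → u # t
  #-sym t#u e = t#u λ s → trans (⊓-comm _ _) (e s)

  ¬#⇒apart : ∀ {t u} → ¬ t # u → ∀ s → (• t) s ≡ 0 ⊎ (• u) s ≡ 0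
  ¬#⇒apart ¬t#u s = m⊓n≡0⇒m≡0⊎n≡0 (decidable-stable em ¬t#u s)

  -- Otherwise `t`, `u`, `v` would form a pure M, fully reachable since `M` covers all three
  -- presets. Transitivity is thus available only among transitions enabled at one reachable
  -- marking.
  #-trans : ∀ {M t u v} → Reachable M → • t ≤ₘ M → • u ≤ₘ M → • v ≤ₘ M →
    t # u → u # v → t # v
  #-trans r p q q′ t#u u#v t∩v = noM (_ , _ , _ , t#u , u#v , t∩v , _ , r ,
    λ s → ⊔-lub (⊔-lub (p s) (q s)) (q′ s))

  #⇒not-together : ∀ {M t u} → Reachable M → t # u → ¬ (∀ s → (• t) s + (• u) s ≤ M s)
  #⇒not-together r t#u p = t#u (scn _ _ (_ , r , pair-enabled p))

  -- Histories are listed most recent first.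
  after : List T → Marking
  after []      = M₀
  after (t ∷ h) = after h ▷ t

  Enabled : List T → T → Set
  Enabled h t = • t ≤ₘ after h

  data Run : List T → Set where
    []  : Run []
    _∷_ : ∀ {t h} → Enabled h t → Run h → Run (t ∷ h)

  run⇒reachable : ∀ {h} → Run h → Reachable (after h)
  run⇒reachable []      = start λ _ → refl
  run⇒reachable (p ∷ r) = fire (run⇒reachable r) (fire-single _ p λ _ → refl)

  -- At each place either `v` needs nothing or `t` takes nothing.
  enabled-persists : ∀ h {t v} → Enabled h v → ¬ v # t → Enabled (t ∷ h) v
  enabled-persists h {t} {v} p ¬v#t s with ¬#⇒apart ¬v#t s
  ... | inj₁ e rewrite e = z≤n
  ... | inj₂ e rewrite e = ≤-trans (p s) (m≤m+n _ _)

  Rival : List T → T → T → Set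
  Rival h u x = Enabled h x × x # u

  -- The enumeration `xs` depends on `h` alone, so members of one class filter the same list and
  -- obtain literally the same name. The default `[]` never occurs along a run.
  rivals : List T → T → List T
  rivals h u with em {FiniteSet (Enabled h)}
  ... | yes (xs , _) = filter (λ x → em {Rival h u x}) xs
  ... | no _         = []

  rivals-complete : ∀ {h u x} → Run h → Rival h u x → x ∈ rivals h u
  rivals-complete {h} {u} r (p , c) with em {FiniteSet (Enabled h)}
  ... | yes (xs , all) = ∈-filter⁺ (λ x → em {Rival h u x}) (all _ p) (p , c)
  ... | no infinite =
    contradiction (map₂ (λ all t p → all t (_ , fire-single t p λ _ → refl))
      (finite-enabled (run⇒reachable r))) infinite

  rivals-sound : ∀ {h u x} → x ∈ rivals h u → x # u
  rivals-sound {h} {u} x∈ with em {FiniteSet (Enabled h)}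
  ... | yes (xs , _) = proj₂ (proj₂ (∈-filter⁻ (λ x → em {Rival h u x}) {xs = xs} x∈))
  rivals-sound () | no _

  rivals-cong : ∀ {h u v} → Run h → Enabled h u → Enabled h v → u # v → rivals h u ≡ rivals h v
  rivals-cong {h} {u} {v} r p q u#v with em {FiniteSet (Enabled h)}
  ... | yes (xs , _) = filter-≐ _ _
    ( (λ (e , x#u) → e , #-trans (run⇒reachable r) e p q x#u u#v)
    , (λ (e , x#v) → e , #-trans (run⇒reachable r) e q p x#v (#-sym u#v))) xs
  ... | no _ = refl

  rivals-injective : ∀ {h u v} → Run h → Enabled h u → rivals h u ≡ rivals h v → u # v
  rivals-injective {h} {u} {v} r p e =
    rivals-sound {h} (subst (u ∈_) e (rivals-complete r (p , #-refl u)))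

  -- A conflict cluster of enabled transitions, named by the time at which it
  -- came up and its members at that time; it may grow later.
  Cluster : Set
  Cluster = ℕ × List T

  Survivor : List T → T → T → Set
  Survivor h t u = ∃[ v ] (Enabled h v × ¬ v # t × v # u)

  -- Names are inherited through survivors, so a class keeps its name while it grows. Which survivor
  -- `em` picks is immaterial by `cluster-cong`, and the date keeps new names apart from inherited
  -- ones.
  cluster : List T → T → Cluster
  cluster [] u = 0 , rivals [] u
  cluster (t ∷ h) u with em {Survivor h t u}
  ... | yes (v , _) = cluster h v
  ... | no _        = length (t ∷ h) , rivals (t ∷ h) u

  cluster-age : ∀ h u → proj₁ (cluster h u) ≤ length h
  cluster-age [] u = z≤n
  cluster-age (t ∷ h) u with em {Survivor h t u}
  ... | yes (v , _) = m≤n⇒m≤1+n (cluster-age h v)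
  ... | no _        = ≤-refl

  private
    survivor-cong : ∀ {h t u v} → Run (t ∷ h) → Enabled (t ∷ h) u → Enabled (t ∷ h) v → u # v →
      Survivor h t u → Survivor h t v
    survivor-cong {h} r p q u#v (w , ew , ¬w#t , w#u) =
      w , ew , ¬w#t , #-trans (run⇒reachable r) (enabled-persists h ew ¬w#t) p q w#u u#v

  -- By transitivity at the current marking, either both transitions have survivors, which conflict
  -- with each other and so had one name before, or neither has and both see the same rivals.
  cluster-cong : ∀ {h u v} → Run h → Enabled h u → Enabled h v → u # v → cluster h u ≡ cluster h v
  cluster-cong [] p q u#v = cong (0 ,_) (rivals-cong [] p q u#v)
  cluster-cong {t ∷ h} {u} {v} r@(_ ∷ r′) p q u#v with em {Survivor h t u} | em {Survivor h t v}
  ... | yes (w , ew , ¬w#t , w#u) | yes (x , ex , ¬x#t , x#v)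
    = cluster-cong r′ ew ex (#-trans R w⁺ q (enabled-persists h ex ¬x#t)
        (#-trans R w⁺ p q w#u u#v) (#-sym x#v))
    where
    R = run⇒reachable r
    w⁺ = enabled-persists h ew ¬w#t
  ... | yes a | no ¬b = contradiction (survivor-cong r p q u#v a) ¬b
  ... | no ¬a | yes b = contradiction (survivor-cong r q p (#-sym u#v) b) ¬a
  ... | no _  | no _  = cong (length (t ∷ h) ,_) (rivals-cong r p q u#v)

  cluster-injective : ∀ {h u v} → Run h → Enabled h u → Enabled h v →
    cluster h u ≡ cluster h v → u # v
  cluster-injective [] p q e = rivals-injective [] p (cong proj₂ e)
  cluster-injective {t ∷ h} {u} {v} r@(_ ∷ r′) p q e with em {Survivor h t u} | em {Survivor h t v}
  ... | yes (w , ew , ¬w#t , w#u) | yes (x , ex , ¬x#t , x#v) =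
    #-trans R p w⁺ q (#-sym w#u) (#-trans R w⁺ (enabled-persists h ex ¬x#t) q
      (cluster-injective r′ ew ex e) x#v)
    where
    R = run⇒reachable r
    w⁺ = enabled-persists h ew ¬w#t
  -- An inherited name dates from at most `length h`, a new one from `suc (length h)`.
  ... | yes (w , _) | no _ =
    contradiction (subst (_≤ length h) (cong proj₁ e) (cluster-age h w)) 1+n≰n
  ... | no _ | yes (x , _) =
    contradiction (subst (_≤ length h) (sym (cong proj₁ e)) (cluster-age h x)) 1+n≰n
  ... | no _ | no _ = rivals-injective r p (cong proj₂ e)

  -- `u` is its own survivor, and whichever one is picked conflicts with `u`, so it had the same
  -- name at `h`.
  cluster-persists : ∀ {h t u} → Run h → Enabled h u → ¬ u # t → cluster (t ∷ h) u ≡ cluster h u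
  cluster-persists {h} {t} {u} r p ¬u#t with em {Survivor h t u}
  ... | yes (v , ev , _ , v#u) = cluster-cong r ev p v#u
  ... | no ¬a = contradiction (u , p , ¬u#t , #-refl u) ¬a

  Live : List T → Cluster → Set
  Live h j = ∃[ u ] (Enabled h u × cluster h u ≡ j)

  -- An old cluster stays live only through a member that does not conflict with `t`. Enabled
  -- members of one cluster conflict mutually, so the fired cluster dies, and its name never
  -- returns.
  live-origin : ∀ {h t j} → Live (t ∷ h) j →
    proj₁ j ≡ length (t ∷ h) ⊎ ∃[ v ] (Enabled h v × ¬ v # t × cluster h v ≡ j)
  live-origin {h} {t} (u , _ , e) with em {Survivor h t u}
  ... | yes (v , ev , ¬v#t , _) = inj₂ (v , ev , ¬v#t , e)
  ... | no _ = inj₁ (sym (cong proj₁ e))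

  live-age : ∀ h {j} → Live h j → proj₁ j ≤ length h
  live-age h (u , _ , refl) = cluster-age h u

-- The coordinated net.

module Coordination (em : ExcludedMiddle 0ℓ) {Act : Set} (N : PetriNet Act)
  (finitary : IsFinitary N) (scn : IsStructuralConflictNet N)
  (noM : ¬ HasFullyReachablePureM N) where

  open PetriNet N
  open Net N
  open Indicator em
  open Clusters em N finitary scn noM

  -- The coordinator's state is the one token on some `history h`. A place for every history lets
  -- `log h i t` know the whole past, and so which locks and offers to add.
  data Place : Set where
    history  : List T → Place
    finished : Cluster → T → Place
    lock     : Cluster → Place
    offer    : Cluster → T → Place

  data Transition : Set where
    run : Cluster → T → Transition
    log : List T → Cluster → T → Transition

  data Input : Place → Transition → Set where
    lock     : ∀ {i t} → Input (lock i) (run i t)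
    offer    : ∀ {i t} → Input (offer i t) (run i t)
    history  : ∀ {h i t} → Input (history h) (log h i t)
    finished : ∀ {h i t} → Input (finished i t) (log h i t)

  -- What the coordinator puts out when the history becomes `h`; for `[]` it is the initial marking.
  -- A lock appears only at the birth of a cluster, but offers are repeated for all enabled
  -- transitions and can pile up. This is harmless, as the lock admits one firing.
  data Opened (h : List T) : Place → Set where
    history : Opened h (history h)
    lock    : ∀ {j} → proj₁ j ≡ length h → Live h j → Opened h (lock j)
    offer   : ∀ {u} → Enabled h u → Opened h (offer (cluster h u) u)

  Output : Transition → Place → Set
  Output (run i t)   s = s ≡ finished i t
  Output (log h i t) s = Opened (t ∷ h) s

  coordinated : PetriNet Act
  coordinated = record
    { S  = Place
    ; T  = Transition
    ; F  = λ { (inj₁ (s , x)) → ⟦ Input s x ⟧ ; (inj₂ (x , s)) → ⟦ Output x s ⟧ }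
    ; M₀ = λ s → ⟦ Opened [] s ⟧
    ; ℓ  = λ { (run i t) → ℓ t ; (log h i t) → τ }
    }

  module N′ where
    open PetriNet coordinated public
    open Net coordinated public

  -- Invariants of the coordinated net.

  Entry : Set
  Entry = Cluster × T

  -- R lists the clusters that fired but are not yet in the history h, each
  -- with its transition.  Offers of such clusters may remain forever, which is
  -- harmless because cluster names are never reused.
  record Consistent (h : List T) (R : List Entry) (m : N′.Marking) : Set where
    field
      is-run         : Run h
      tracked        : All (λ (i , t) → Enabled h t × cluster h t ≡ i) R
      distinct       : Unique (map proj₁ R)
      at-history     : ∀ g → m (history g) ≡ ⟦ g ≡ h ⟧
      at-lock        : ∀ j → m (lock j) ≡ ⟦ (Live h j × j ∉ map proj₁ R) ⟧
      offer-sound    : ∀ {j u} → Live h j → 1 ≤ m (offer j u) → Enabled h u × cluster h u ≡ j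
      offer-complete : ∀ {u} → Enabled h u → cluster h u ∉ map proj₁ R →
                       1 ≤ m (offer (cluster h u) u)
      -- Keeps future clusters free of stale tokens, so that `offer-sound` holds when such a cluster
      -- is born.
      offer-fresh    : ∀ {j u} → length h < proj₁ j → m (offer j u) ≡ 0

  open Consistent

  consistent-≗ : ∀ {h R m m′} → m ≗ m′ → Consistent h R m → Consistent h R m′
  consistent-≗ e c = record
    { is-run         = is-run c
    ; tracked        = tracked c
    ; distinct       = distinct c
    ; at-history     = λ g → trans (sym (e _)) (at-history c g)
    ; at-lock        = λ j → trans (sym (e _)) (at-lock c j)
    ; offer-sound    = λ l p → offer-sound c l (subst (1 ≤_) (sym (e _)) p)
    ; offer-complete = λ p n → subst (1 ≤_) (e _) (offer-complete c p n)
    ; offer-fresh    = λ p → trans (sym (e _)) (offer-fresh c p)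
    }

  consistent-↭ : ∀ {h R R′ m} → R ↭ R′ → Consistent h R m → Consistent h R′ m
  consistent-↭ {R = R} {R′} p c = record
    { is-run         = is-run c
    ; tracked        = All-resp-↭ p (tracked c)
    ; distinct       = Unique-resp-↭ (map⁺ proj₁ p) (distinct c)
    ; at-history     = at-history c
    ; at-lock        = λ j → trans (at-lock c j) (⟦⟧-cong (map₂ (_∘ ∈⁻)) (map₂ (_∘ ∈⁺)))
    ; offer-sound    = offer-sound c
    ; offer-complete = λ q n → offer-complete c q (n ∘ ∈⁺)
    ; offer-fresh    = offer-fresh c
    }
    where
    ∈⁺ : ∀ {j} → j ∈ map proj₁ R → j ∈ map proj₁ R′
    ∈⁺ = ∈-resp-↭ (map⁺ proj₁ p)
    ∈⁻ : ∀ {j} → j ∈ map proj₁ R′ → j ∈ map proj₁ R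
    ∈⁻ = ∈-resp-↭ (map⁺ proj₁ (↭-sym p))

  consistent-init : Consistent [] [] N′.M₀
  consistent-init = record
    { is-run         = []
    ; tracked        = []
    ; distinct       = []
    ; at-history     = λ g → ⟦⟧-cong (λ { history → refl }) (λ { refl → history })
    ; at-lock        = λ j → ⟦⟧-cong (λ { (lock _ l) → l , λ () })
                         (λ { (l , _) → lock (n≤0⇒n≡0 (live-age [] l)) l })
    ; offer-sound    = λ _ p → sound (⟦⟧-witness p)
    ; offer-complete = λ p _ → ≤-reflexive (sym (⟦⟧-yes (offer p)))
    ; offer-fresh    = λ {_} {u} p → ⟦⟧-no λ { (offer _) → 1+n≰n (≤-trans p (cluster-age [] u)) }
    }
    where
    sound : ∀ {j u} → Opened [] (offer j u) → Enabled [] u × cluster [] u ≡ j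
    sound (offer p) = p , refl

  module _ {h R m} (c : Consistent h R m) where

    entry-live : ∀ {i} → i ∈ map proj₁ R → Live h i
    entry-live i∈ with ∈-map⁻ proj₁ i∈
    ... | (i , t) , r∈ , refl = t , All.lookup (tracked c) r∈

    can-run : ∀ {t} → Enabled h t → cluster h t ∉ map proj₁ R → N′.• run (cluster h t) t ≤ₘ m
    can-run {t} p n (history g) = ≤-trans (≤-reflexive (⟦⟧-no (λ ()))) z≤n
    can-run {t} p n (finished i u) = ≤-trans (≤-reflexive (⟦⟧-no (λ ()))) z≤n
    can-run {t} p n (lock j) with em {j ≡ cluster h t}
    ... | yes refl = ≤-trans ⟦⟧≤1
      (≤-reflexive (sym (trans (at-lock c _) (⟦⟧-yes ((t , p , refl) , n)))))
    ... | no j≢ = ≤-trans (≤-reflexive (⟦⟧-no λ { lock → j≢ refl })) z≤n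
    can-run {t} p n (offer j u) with em {(j , u) ≡ (cluster h t , t)}
    ... | yes refl = ≤-trans ⟦⟧≤1 (offer-complete c p n)
    ... | no j≢ = ≤-trans (≤-reflexive (⟦⟧-no λ { offer → j≢ refl })) z≤n

    -- The token on the lock shows the cluster to be live and unfired; only for a live cluster does
    -- `offer-sound` give the offer a meaning.
    run-sound : ∀ {i t} → N′.• run i t ≤ₘ m → Enabled h t × cluster h t ≡ i × i ∉ map proj₁ R
    run-sound {i} {t} p with ⟦⟧-witness (subst (1 ≤_) (at-lock c i)
      (≤-trans (≤-reflexive (sym (⟦⟧-yes Input.lock))) (p (lock i))))
    ... | l , n
      with offer-sound c l (≤-trans (≤-reflexive (sym (⟦⟧-yes Input.offer))) (p (offer i t)))
    ... | e , q = e , q , n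

    consistent-start : ∀ {t} → Enabled h t → cluster h t ∉ map proj₁ R →
      Consistent h ((cluster h t , t) ∷ R) (m ⊖ N′.• run (cluster h t) t)
    consistent-start {t} p n = record
      { is-run         = is-run c
      ; tracked        = (p , refl) ∷ tracked c
      ; distinct       =
          All.tabulate (λ i∈ e → n (subst (_∈ map proj₁ R) (sym e) i∈)) ∷ distinct c
      ; at-history     = λ g → trans (cong (m (history g) ∸_) (⟦⟧-no λ ())) (at-history c g)
      ; at-lock        = λ j → trans (cong (_∸ ⟦ Input (lock j) x ⟧) (at-lock c j))
          (⟦⟧-∸ (λ (l , q) → (l , q ∘ there) , λ { lock → q (here refl) })
            (λ (l , q) ¬i → l , λ { (here refl) → ¬i lock ; (there j∈) → q j∈ }))
      ; offer-sound    = λ {j} {u} l q → offer-sound c l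
          (≤-trans q (m∸n≤m (m (offer j u)) ⟦ Input (offer j u) x ⟧))
      -- The offer spent belongs to a cluster that now has an entry, and such clusters are exempt.
      ; offer-complete = λ q k → subst (1 ≤_)
          (sym (cong (m (offer _ _) ∸_) (⟦⟧-no λ { offer → k (here refl) })))
          (offer-complete c q (k ∘ there))
      ; offer-fresh    = λ {j} {u} q → n≤0⇒n≡0 (≤-trans (m∸n≤m _ ⟦ Input (offer j u) x ⟧)
          (≤-reflexive (offer-fresh c q)))
      }
      where x = run (cluster h t) t

    -- Only `finished i t` changes, a place on which `Consistent` is silent.
    consistent-end : ∀ {i t} → Consistent h R (m ⊕ run i t N′.•)
    consistent-end {i} {t} = record
      { is-run         = is-run c
      ; tracked        = tracked c
      ; distinct       = distinct c
      ; at-history     = λ g → trans (unchanged λ ()) (at-history c g)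
      ; at-lock        = λ j → trans (unchanged λ ()) (at-lock c j)
      ; offer-sound    = λ l p → offer-sound c l (subst (1 ≤_) (unchanged λ ()) p)
      ; offer-complete = λ p n → ≤-trans (offer-complete c p n) (m≤m+n _ _)
      ; offer-fresh    = λ p → trans (unchanged λ ()) (offer-fresh c p)
      }
      where
      unchanged : ∀ {s} → s ≢ finished i t → m s + ⟦ s ≡ finished i t ⟧ ≡ m s
      unchanged {s} s≢ = trans (cong (m s +_) (⟦⟧-no s≢)) (+-identityʳ (m s))

  -- Although the entry of `i` disappears, `at-lock` stays true: the cluster is no longer live, so
  -- its lock rightly remains empty. Entries of other clusters do not conflict with `t` and persist
  -- under their names.
  consistent-log : ∀ {h i t R m} → Consistent h ((i , t) ∷ R) m →
    Consistent (t ∷ h) R (m N′.▷ log h i t)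
  consistent-log {h} {i} {t} {R} {m} c = record
    { is-run         = et ∷ is-run c
    ; tracked        = All.tabulate λ r∈ → tracked′ (All.lookup Rs r∈)
        (λ e → All.lookup i∉ (∈-map⁺ proj₁ r∈) (sym e))
    ; distinct       = AllPairs.tail (distinct c)
    ; at-history     = λ g → trans
        (cong (_+ ⟦ Opened (t ∷ h) (history g) ⟧)
          (trans (cong (_∸ ⟦ Input (history g) x ⟧) (at-history c g))
            (⟦⟧-∸ {R = ⊥} (λ ()) (λ { refl ¬i → ¬i history }))))
        (⟦⟧-+ proj₁ (λ { refl → inj₂ history }) (λ { (inj₂ history) → refl }))
    ; at-lock        = λ j → trans (unlogged λ ())
        (trans (cong (_+ ⟦ Opened (t ∷ h) (lock j) ⟧) (at-lock c j))
          (⟦⟧-+ (λ { ((l , _) , lock e _) → old l e }) lock⁻ lock⁺))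
    ; offer-sound    = sound
    ; offer-complete = λ {u} p n → subst (1 ≤_) (sym (unlogged λ ()))
        (≤-trans (≤-reflexive (sym (⟦⟧-yes (offer p)))) (m≤n+m _ (m (offer _ u))))
    ; offer-fresh    = λ {j} {u} p → trans (unlogged λ ()) (cong₂ _+_
        (offer-fresh c (≤-trans (n≤1+n _) p))
        (⟦⟧-no λ { (offer _) → 1+n≰n (≤-trans p (cluster-age (t ∷ h) u)) }))
    }
    where
    x = log h i t
    r = is-run c
    Rs = All.tail (tracked c)
    i∉ = AllPairs.head (distinct c)
    et : Enabled h t
    et = proj₁ (All.head (tracked c))
    ct : cluster h t ≡ i
    ct = proj₂ (All.head (tracked c))

    unlogged : ∀ {s} → ¬ Input s x → (m N′.▷ x) s ≡ m s + ⟦ Opened (t ∷ h) s ⟧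
    unlogged {s} ¬i = cong (λ k → m s ∸ k + ⟦ Opened (t ∷ h) s ⟧) (⟦⟧-no ¬i)

    old : ∀ {j} → Live h j → proj₁ j ≢ suc (length h)
    old l e = 1+n≰n (subst (_≤ length h) e (live-age h l))

    cluster≢⇒¬# : ∀ {u} → Enabled h u → cluster h u ≢ i → ¬ u # t
    cluster≢⇒¬# eu j≢i u#t = j≢i (trans (cluster-cong r eu et u#t) ct)

    ¬#⇒cluster≢ : ∀ {u} → Enabled h u → ¬ u # t → cluster h u ≢ i
    ¬#⇒cluster≢ eu ¬u#t e = ¬u#t (cluster-injective r eu et (trans e (sym ct)))

    tracked′ : ∀ {j u} → Enabled h u × cluster h u ≡ j → j ≢ i →
      Enabled (t ∷ h) u × cluster (t ∷ h) u ≡ j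
    tracked′ (eu , refl) j≢i =
      enabled-persists h eu ¬u#t , cluster-persists r eu ¬u#t
      where ¬u#t = cluster≢⇒¬# eu j≢i

    lock⁻ : ∀ {j} → Live (t ∷ h) j × j ∉ map proj₁ R →
      (Live h j × j ∉ i ∷ map proj₁ R) ⊎ Opened (t ∷ h) (lock j)
    lock⁻ (l , n) with live-origin l
    ... | inj₁ e = inj₂ (lock e l)
    ... | inj₂ (v , ev , ¬v#t , refl) = inj₁ ((v , ev , refl) ,
      λ { (here e) → ¬#⇒cluster≢ ev ¬v#t e ; (there j∈) → n j∈ })

    lock⁺ : ∀ {j} → (Live h j × j ∉ i ∷ map proj₁ R) ⊎ Opened (t ∷ h) (lock j) →
      Live (t ∷ h) j × j ∉ map proj₁ R
    lock⁺ (inj₁ ((u , p) , n)) = (u , tracked′ p (n ∘ here)) , n ∘ there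
    lock⁺ (inj₂ (lock e l)) = l , λ j∈ → old (entry-live c (there j∈)) e

    sound : ∀ {j u} → Live (t ∷ h) j → 1 ≤ (m N′.▷ x) (offer j u) →
      Enabled (t ∷ h) u × cluster (t ∷ h) u ≡ j
    sound {j} {u} l p = by-origin (live-origin l) em
      where
      earlier : ¬ Opened (t ∷ h) (offer j u) → 1 ≤ m (offer j u)
      earlier ¬o = subst (1 ≤_) (trans (unlogged λ ())
        (trans (cong (m (offer j u) +_) (⟦⟧-no ¬o)) (+-identityʳ _))) p
      by-origin : proj₁ j ≡ length (t ∷ h) ⊎ ∃[ v ] (Enabled h v × ¬ v # t × cluster h v ≡ j) →
        Dec (Opened (t ∷ h) (offer j u)) → Enabled (t ∷ h) u × cluster (t ∷ h) u ≡ j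
      by-origin _ (yes (offer eu)) = eu , refl
      -- A token not just added would predate the birth of its cluster, against `offer-fresh`.
      by-origin (inj₁ e) (no ¬o) =
        contradiction (subst (1 ≤_) (offer-fresh c (≤-reflexive (sym e))) (earlier ¬o)) λ ()
      by-origin (inj₂ (v , ev , ¬v#t , refl)) (no ¬o) =
        tracked′ (offer-sound c (v , ev , refl) (earlier ¬o)) (¬#⇒cluster≢ ev ¬v#t)

  -- P lists the transitions that finished but are not yet logged.
  record Logging (h : List T) (P Q : List Entry) (m : N′.Marking) : Set where
    field
      consistent  : Consistent h (P ++ Q) m
      at-finished : ∀ i t → m (finished i t) ≡ ⟦ (i , t) ∈ P ⟧

  open Logging

  logging-≗ : ∀ {h P Q m m′} → m ≗ m′ → Logging h P Q m → Logging h P Q m′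
  logging-≗ e l = record
    { consistent  = consistent-≗ e (consistent l)
    ; at-finished = λ i t → trans (sym (e _)) (at-finished l i t)
    }

  logging-init : Logging [] [] [] N′.M₀
  logging-init = record
    { consistent  = consistent-init
    ; at-finished = λ i t → ⟦⟧-cong (λ ()) (λ ())
    }

  logging-start : ∀ {h P Q m t} → Logging h P Q m → Enabled h t →
    cluster h t ∉ map proj₁ (P ++ Q) →
    Logging h P (Q ∷ʳ (cluster h t , t)) (m ⊖ N′.• run (cluster h t) t)
  logging-start {P = P} {m = m} l p n = record
    { consistent  = consistent-↭ (↭-sym (∷ʳ↭∷ P)) (consistent-start (consistent l) p n)
    ; at-finished = λ i u → trans (cong (m (finished i u) ∸_) (⟦⟧-no λ ())) (at-finished l i u)
    }

  private
    ∉-rest : ∀ {h R x m y} {P : List Entry} → Consistent h (x ∷ R) m →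
      (∀ {z} → z ∈ P → z ∈ R) → y ∈ P → y ≢ x
    ∉-rest c P⊆R y∈ refl = All.lookup (AllPairs.head (distinct c)) (∈-map⁺ proj₁ (P⊆R y∈)) refl

  -- Entries have distinct clusters, so `finished i t` was empty and its count remains an indicator.
  logging-end : ∀ {h P Q Q′ m i t} → Logging h P Q m → Q ↭ (i , t) ∷ Q′ →
    Logging h ((i , t) ∷ P) Q′ (m ⊕ run i t N′.•)
  logging-end {h} {P} {Q} {Q′} {m} {i} {t} l Q↭ = record
    { consistent  = consistent-end c
    ; at-finished = λ j u → trans (cong (_+ ⟦ finished j u ≡ finished i t ⟧) (at-finished l j u))
        (⟦⟧-+ (λ { (∈P , refl) → ∉-rest {P = P} c ∈-++⁺ˡ ∈P refl })
          (λ { (here refl) → inj₂ refl ; (there ∈P) → inj₁ ∈P })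
          (λ { (inj₁ ∈P) → there ∈P ; (inj₂ refl) → here refl }))
    }
    where
    c : Consistent h ((i , t) ∷ P ++ Q′) m
    c = consistent-↭ (↭-trans (++⁺ˡ P Q↭) (shift (i , t) P Q′)) (consistent l)

  -- `Enabled h t` is returned as well because the subtraction in `after (t ∷ h)` is truncated and
  -- `simulates-log` needs it to be exact.
  logging-log : ∀ {h P P′ Q m i t} → Logging h P Q m → P ↭ (i , t) ∷ P′ →
    Enabled h t × Logging (t ∷ h) P′ Q (m N′.▷ log h i t)
  logging-log {h} {P} {P′} {Q} {m} {i} {t} l P↭ = proj₁ (All.head (tracked c)) , record
    { consistent  = consistent-log c
    ; at-finished = λ j u → trans
        (cong (m (finished j u) ∸ ⟦ Input (finished j u) (log h i t) ⟧ +_) (⟦⟧-no λ ()))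
        (trans (+-identityʳ _)
          (trans (cong (_∸ ⟦ Input (finished j u) (log h i t) ⟧) (at-finished l j u))
            (⟦⟧-∸
              (λ ∈P′ → ∈-resp-↭ (↭-sym P↭) (there ∈P′) ,
                λ { finished → ∉-rest {P = P′} c ∈-++⁺ˡ ∈P′ refl })
              (λ ∈P ¬i → rest ¬i (∈-resp-↭ P↭ ∈P)))))
    }
    where
    c : Consistent h ((i , t) ∷ P′ ++ Q) m
    c = consistent-↭ (++⁺ʳ Q P↭) (consistent l)
    rest : ∀ {j u} → ¬ Input (finished j u) (log h i t) → (j , u) ∈ (i , t) ∷ P′ →
      (j , u) ∈ P′
    rest ¬i (here refl) = contradiction finished ¬i
    rest ¬i (there ∈P′) = ∈P′

  can-log : ∀ {h P Q m i t} → Logging h P Q m → (i , t) ∈ P → N′.• log h i t ≤ₘ m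
  can-log {h} {m = m} {i} {t} l ∈P s with em {Input s (log h i t)}
  ... | no _ = z≤n
  ... | yes history = ≤-reflexive (sym (trans (at-history (consistent l) h) (⟦⟧-yes refl)))
  ... | yes finished = ≤-reflexive (sym (trans (at-finished l i t) (⟦⟧-yes ∈P)))

  log-sound : ∀ {h P Q m g i t} → Logging h P Q m → N′.• log g i t ≤ₘ m → g ≡ h × (i , t) ∈ P
  log-sound {g = g} {i} {t} l p =
    ⟦⟧-witness (subst (1 ≤_) (at-history (consistent l) g)
      (≤-trans (≤-reflexive (sym (⟦⟧-yes Input.history))) (p (history g)))) ,
    ⟦⟧-witness (subst (1 ≤_) (at-finished l i t)
      (≤-trans (≤-reflexive (sym (⟦⟧-yes Input.finished))) (p (finished i t))))

  Idle : N′.Marking → Set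
  Idle m = ∃[ h ] ∃[ P ] Logging h P [] m

  -- In an ordinary firing a `run` is a start followed at once by its end, so no transition is left
  -- running.
  idle-step : ∀ {m} x → N′.• x ≤ₘ m → Idle m → Idle (m N′.▷ x)
  idle-step (run i t) p (h , P , l) with run-sound (consistent l) p
  ... | e , refl , n = h , (i , t) ∷ P , logging-end (logging-start l e n) ↭-refl
  idle-step (log g i t) p (h , P , l) with log-sound l p
  ... | refl , ∈P with ∈⇒↭ ∈P
  ... | P′ , P↭ = t ∷ h , P′ , proj₂ (logging-log l P↭)

  reachable⇒idle : ∀ {m} → N′.Reachable m → Idle m
  reachable⇒idle = N′.Invariant.reachable Idle (λ e (h , P , l) → h , P , logging-≗ e l)
    idle-step ([] , [] , logging-init)

  -- Assignment of locations.

  coordinated-distributed : IsDistributed coordinated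
  coordinated-distributed = record
    { Location    = Maybe Cluster
    ; D           = [ place , transition ]′
    ; co-located  = λ s x n → co-located (⟦⟧-witness (n≢0⇒n>0 n))
    ; distributed = λ { x y (m , r , f) → apart x y (N′.pair-pre f) (reachable⇒idle r) }
    }
    where
    place : Place → Maybe Cluster
    -- Here `τ` is merely the pattern for `nothing`, and stands for the coordinator's location.
    place (history _)    = τ
    place (finished _ _) = τ
    place (lock i)       = just i
    place (offer i _)    = just i

    transition : Transition → Maybe Cluster
    transition (run i _)   = just i
    transition (log _ _ _) = τ

    co-located : ∀ {s x} → Input s x → transition x ≡ place s
    co-located lock     = refl
    co-located offer    = refl
    co-located history  = refl
    co-located finished = refl

    twice : ∀ {s x y n} → Input s x → Input s y → n ≤ 1 → ¬ (N′.• x) s + (N′.• y) s ≤ n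
    twice p q ≤1 le = 1+n≰n
      (≤-trans (≤-reflexive (sym (cong₂ _+_ (⟦⟧-yes p) (⟦⟧-yes q)))) (≤-trans le ≤1))

    apart : ∀ {m} x y → (∀ s → (N′.• x) s + (N′.• y) s ≤ m s) → Idle m →
      transition x ≢ transition y
    -- Transitions at one location compete for a single token: the lock of their cluster, or the
    -- current history.
    apart (run i t) (run .i u) p (h , P , l) refl =
      twice Input.lock Input.lock
        (≤-trans (≤-reflexive (at-lock (consistent l) i)) ⟦⟧≤1) (p (lock i))
    apart (log g i t) (log f j u) p (h , P , l) _
      with refl , _ ← log-sound l (λ s → m+n≤o⇒m≤o _ (p s))
         | refl , _ ← log-sound l (λ s → m+n≤o⇒n≤o _ (p s)) =
      twice Input.history Input.history
        (≤-trans (≤-reflexive (at-history (consistent l) h)) ⟦⟧≤1) (p (history h))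

  -- The simulation relation and its moves.

  record Simulates (P : List Entry) (p : STMarking coordinated) (q : STMarking N) : Set where
    field
      past     : List T
      running  : List Entry
      logging  : Logging past P running (proj₁ p)
      threads′ : proj₂ p ≡ map (uncurry run) running
      threads  : proj₂ q ≡ map proj₂ running
      -- The marking of `N` is `after past`, less what all unlogged transitions consumed, plus what
      -- the finished ones among them produced. The additive form avoids truncated subtraction.
      balance  : ∀ s → proj₁ q s + pre (map proj₂ (P ++ running)) s ≡
                       after past s + post (map proj₂ P) s

  pre-entries : ∀ {R R′ : List Entry} → R ↭ R′ → ∀ s →
    pre (map proj₂ R) s ≡ pre (map proj₂ R′) s
  pre-entries R↭ = pre-↭ (map⁺ proj₂ R↭)

  simulates-start : ∀ {P m U′ M U} (b : Simulates P (m , U′) (M , U)) →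
    let h = Simulates.past b in
    ∀ {t} → Enabled h t → cluster h t ∉ map proj₁ (P ++ Simulates.running b) → • t ≤ₘ M →
    ∀ {m₂ M₂} → m₂ ≗ m ⊖ N′.• run (cluster h t) t → M₂ ≗ M ⊖ • t →
    Simulates P (m₂ , U′ ∷ʳ run (cluster h t) t) (M₂ , U ∷ʳ t)
  simulates-start {P} {M = M}
    record { past = h ; running = Q ; logging = l ; threads′ = refl ; threads = refl ; balance = bal }
    {t} e n p m≗ M≗ = record
    { past     = h
    ; running  = Q ∷ʳ (cluster h t , t)
    ; logging  = logging-≗ (λ s → sym (m≗ s)) (logging-start l e n)
    ; threads′ = sym (map-++ (uncurry run) Q _)
    ; threads  = sym (map-++ proj₂ Q _)
    ; balance  = λ s → begin
        _                                       ≡⟨ cong₂ _+_ (M≗ s) (pre-entries (∷ʳ↭∷ P) s) ⟩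
        M s ∸ (• t) s + ((• t) s + waiting s)   ≡⟨ +-assoc (M s ∸ (• t) s) _ _ ⟨
        M s ∸ (• t) s + (• t) s + waiting s     ≡⟨ cong (_+ waiting s) (m∸n+n≡m (p s)) ⟩
        M s + waiting s                         ≡⟨ bal s ⟩
        _                                       ∎
    }
    where
    open ≡-Reasoning
    waiting : Marking
    waiting = pre (map proj₂ (P ++ Q))

  simulates-end : ∀ {P m U′ M U} (b : Simulates P (m , U′) (M , U)) →
    let Q = Simulates.running b in ∀ k {m₂ U′₂ M₂ U₂} →
    m₂ ≗ m ⊕ uncurry run (lookup Q k) N′.• → U′₂ ≡ map (uncurry run) (removeAt Q k) →
    M₂ ≗ M ⊕ proj₂ (lookup Q k) • → U₂ ≡ map proj₂ (removeAt Q k) →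
    Simulates (lookup Q k ∷ P) (m₂ , U′₂) (M₂ , U₂)
  simulates-end {P} {M = M}
    record { past = h ; running = Q ; logging = l ; balance = bal } k m≗ eU′ M≗ eU = record
    { past     = h
    ; running  = removeAt Q k
    ; logging  = logging-≗ (λ s → sym (m≗ s)) (logging-end l (removeAt-↭ Q k))
    ; threads′ = eU′
    ; threads  = eU
    ; balance  = λ s → begin
        _                                ≡⟨ cong₂ _+_ (M≗ s) (pre-entries moved s) ⟩
        M s + (t •) s + waiting s        ≡⟨ cong (_+ waiting s) (+-comm (M s) _) ⟩
        (t •) s + M s + waiting s        ≡⟨ +-assoc ((t •) s) _ _ ⟩
        (t •) s + (M s + waiting s)      ≡⟨ cong ((t •) s +_) (bal s) ⟩
        (t •) s + (after h s + output s) ≡⟨ +-assoc ((t •) s) _ _ ⟨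
        (t •) s + after h s + output s   ≡⟨ cong (_+ output s) (+-comm _ (after h s)) ⟩
        after h s + (t •) s + output s   ≡⟨ +-assoc (after h s) _ _ ⟩
        _                                ∎
    }
    where
    open ≡-Reasoning
    t = proj₂ (lookup Q k)
    waiting output : Marking
    waiting = pre (map proj₂ (P ++ Q))
    output  = post (map proj₂ P)
    moved : lookup Q k ∷ P ++ removeAt Q k ↭ P ++ Q
    moved = ↭-trans (↭-sym (shift (lookup Q k) P (removeAt Q k)))
      (++⁺ˡ P (↭-sym (removeAt-↭ Q k)))

  simulates-log : ∀ {P P′ i t m U′ M U} (b : Simulates P (m , U′) (M , U)) →
    P ↭ (i , t) ∷ P′ → ∀ {m₂} → m₂ ≗ m N′.▷ log (Simulates.past b) i t → Simulates P′ (m₂ , U′) (M , U)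
  simulates-log {P} {P′} {i} {t} {M = M}
    record { past = h ; running = Q ; logging = l ; threads′ = e′ ; threads = e ; balance = bal }
    P↭ m≗ with logging-log l P↭
  ... | et , l′ = record
    { past     = t ∷ h
    ; running  = Q
    ; logging  = logging-≗ (λ s → sym (m≗ s)) l′
    ; threads′ = e′
    ; threads  = e
    -- The tokens consumed and produced by `t` move from the unlogged entries into `after`, while
    -- `M` stays the same.
    ; balance  = λ s → fire-balance {M s} (trans
        (cong (M s +_) (sym (pre-entries (++⁺ʳ Q P↭) s)))
        (trans (bal s) (cong (after h s +_) (post-↭ (map⁺ proj₂ P↭) s)))) (et s)
    }

  Bisimilar : STMarking coordinated → STMarking N → Set
  Bisimilar p q = ∃[ P ] Simulates P p q

  -- The entries belong to other clusters and do not conflict with `t`. So they took nothing from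
  -- its pre-places, where `M` is thus at least `after h`.
  ready-in-N : ∀ {P p q} (b : Simulates P p q) → let h = Simulates.past b in
    ∀ {t} → Enabled h t → cluster h t ∉ map proj₁ (P ++ Simulates.running b) → • t ≤ₘ proj₁ q
  ready-in-N {P} {q = M , _}
    record { past = h ; running = Q ; logging = l ; balance = bal } {t} e n s =
    [ (λ t≡0 → subst (_≤ M s) (sym t≡0) z≤n) , (λ pre≡0 → ≤-trans (e s) (bound pre≡0)) ]′
      (disjoint (P ++ Q) others)
    where
    c = consistent l
    others : ∀ {i u} → (i , u) ∈ P ++ Q → ¬ t # u
    others {i} {u} ∈R t#u with eu , refl ← All.lookup (tracked c) ∈R =
      n (subst (_∈ map proj₁ (P ++ Q)) (sym (cluster-cong (is-run c) e eu t#u)) (∈-map⁺ proj₁ ∈R))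
    disjoint : ∀ R → (∀ {i u} → (i , u) ∈ R → ¬ t # u) → (• t) s ≡ 0 ⊎ pre (map proj₂ R) s ≡ 0
    disjoint [] _ = inj₂ refl
    disjoint ((i , u) ∷ R) f with ¬#⇒apart (f (here refl)) s | disjoint R (f ∘ there)
    ... | inj₁ e₁ | _       = inj₁ e₁
    ... | inj₂ _  | inj₁ e₁ = inj₁ e₁
    ... | inj₂ e₁ | inj₂ e₂ = inj₂ (cong₂ _+_ e₁ e₂)
    bound : pre (map proj₂ (P ++ Q)) s ≡ 0 → after h s ≤ M s
    bound pre≡0 = ≤-trans (m≤m+n _ _) (≤-reflexive
      (trans (sym (bal s)) (trans (cong (M s +_) pre≡0) (+-identityʳ _))))

  -- With nothing left to log, `M` plus what the running transitions took is `after h`. Were the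
  -- cluster of `t` busy, its running member would conflict with `t` and yet fit beside it into this
  -- reachable marking.
  ready-in-coordinated : ∀ {p q} (b : Simulates [] p q) → let h = Simulates.past b in
    ∀ {t} → • t ≤ₘ proj₁ q → Enabled h t × cluster h t ∉ map proj₁ (Simulates.running b)
  ready-in-coordinated {q = M , _}
    record { past = h ; running = Q ; logging = l ; balance = bal } {t} p = e , n
    where
    c = consistent l
    total : ∀ s → M s + pre (map proj₂ Q) s ≡ after h s
    total s = trans (bal s) (+-identityʳ _)
    e : Enabled h t
    e s = ≤-trans (p s) (≤-trans (m≤m+n _ _) (≤-reflexive (total s)))
    n : cluster h t ∉ map proj₁ Q
    n i∈ with (i , u) , ∈Q , refl ← ∈-map⁻ proj₁ i∈ with Q′ , Q↭ ← ∈⇒↭ ∈Q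
      with eu , same ← All.lookup (tracked c) ∈Q =
      #⇒not-together (run⇒reachable (is-run c)) (cluster-injective (is-run c) e eu (sym same))
        λ s → ≤-trans
          (+-mono-≤ (p s) (≤-trans (m≤m+n _ _) (≤-reflexive (sym (pre-entries Q↭ s)))))
          (≤-reflexive (total s))

  -- Branching bisimilarity and termination of logging.

  private
    L′ = ST-LTS coordinated
    L  = ST-LTS N

  -- The coordinator catches up while `N` stands still, since `simulates-log` leaves the state of
  -- `N` untouched.
  log-everything : ∀ P {m U′ q} → Simulates P (m , U′) q →
    ∃[ m₂ ] (_⟹_ L′ (m , U′) (m₂ , U′) × Simulates [] (m₂ , U′) q)
  log-everything [] b = _ , ε , b
  log-everything ((i , t) ∷ P) b
    with m₂ , steps , b₂ ← log-everything P (simulates-log b ↭-refl λ _ → refl) =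
    m₂ , ((log _ i t , refl ,
      N′.fire-single (log _ i t) (can-log (Simulates.logging b) (here refl))
        λ _ → refl) , refl) ◅ steps , b₂

  module _ (visible : ∀ t → ℓ t ≢ τ) where

    -- Only `log` transitions are silent, and each removes one entry from `P`. So `N` may answer by
    -- staying put, and the length of `P` bounds every silent run.
    silent-step : ∀ {P p p₂ q} → Simulates P p q → _⟶⟨_⟩_ L′ p τ p₂ →
      ∃[ P₂ ] (length P ≡ suc (length P₂) × Simulates P₂ p₂ q)
    silent-step b ((run i t , e , _) , _) = contradiction e (visible t)
    silent-step b ((log g i t , _ , f) , refl) with log-sound (Simulates.logging b) (N′.single-pre f)
    ... | refl , ∈P with ∈⇒↭ ∈P
    ... | P₂ , P↭ = P₂ , ↭-length P↭ , simulates-log b P↭ (N′.single-post f)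

    forward : Transfer L′ L Bisimilar
    forward {q = q} {τ} {p₂} (P , b) step with P₂ , _ , b₂ ← silent-step b step =
      q , q , ε , inj₂ (refl , refl) , (P , b) , (P₂ , b₂)
    forward {q = M , U} {just (a ⁺)} {p₂} (P , b) (run i t , e , f , m≗ , refl)
      with run-sound (consistent (Simulates.logging b)) (N′.single-pre (proj₂ f))
    ... | et , refl , n = (M , U) , (M ⊖ • t , U ∷ʳ t) , ε ,
      inj₁ (t , e , (_ , fire-single t p λ _ → refl) , (λ _ → refl) , refl) , (P , b) ,
      (P , simulates-start b et n p m≗ λ _ → refl)
      where p = ready-in-N b et n
    forward {q = M , _} {just (a ⁻ n)}
      (P , b@(record { running = Q ; threads′ = refl ; threads = refl })) (i , refl , e , refl , m≗)
      with k , i≡k , look , rem ← position-map⁻ (uncurry run) Q i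
      with j , j≡k , look₂ , rem₂ ← position-map⁺ proj₂ Q k
      rewrite look =
      _ , (M ⊕ lookup (map proj₂ Q) j • , removeAt (map proj₂ Q) j) , ε ,
      inj₁ (j , cong suc (trans j≡k (sym i≡k)) , trans (cong ℓ look₂) e , refl , λ _ → refl) ,
      (P , b) ,
      (_ , simulates-end b k m≗ rem (λ s → cong (λ u → M s + (u •) s) look₂) rem₂)

    backward : Transfer L L′ (flip Bisimilar)
    backward {α = τ} _ ((t , e , _) , _) = contradiction e (visible t)
    backward {q = m , U′} {just (a ⁺)} (P , b) (t , e , f , M≗ , refl)
      -- A transition enabled by unlogged firings is offered only once they are logged, hence the
      -- silent moves before the answer.
      with m₂ , steps , b₂ ← log-everything P b
      with et , n ← ready-in-coordinated b₂ (single-pre (proj₂ f)) =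
      (m₂ , U′) , (m₂ ⊖ N′.• x , U′ ∷ʳ x) , steps ,
      inj₁ (x , e ,
        (_ , N′.fire-single x (can-run (consistent (Simulates.logging b₂)) et n) λ _ → refl) ,
        (λ _ → refl) , refl) ,
      ([] , b₂) , ([] , simulates-start b₂ et n (single-pre (proj₂ f)) (λ _ → refl) M≗)
      where x = run (cluster (Simulates.past b₂) t) t
    backward {q = m , _} {just (a ⁻ n)}
      (P , b@(record { running = Q ; threads′ = refl ; threads = refl })) (i , refl , e , refl , M≗)
      with k , i≡k , look , rem ← position-map⁻ proj₂ Q i
      with j , j≡k , look₂ , rem₂ ← position-map⁺ (uncurry run) Q k
      rewrite look =
      _ , (m ⊕ lookup (map (uncurry run) Q) j N′.• , removeAt (map (uncurry run) Q) j) , ε ,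
      inj₁ (j , cong suc (trans j≡k (sym i≡k)) , trans (cong N′.ℓ look₂) e , refl , λ _ → refl) ,
      (P , b) ,
      (_ , simulates-end b k (λ s → cong (λ x → m s + (x N′.•) s) look₂) rem₂ M≗ rem)

    no-divergence : ∀ n {P q} (p : ℕ → STMarking coordinated) →
      (∀ k → _⟶⟨_⟩_ L′ (p k) τ (p (suc k))) → Simulates P (p 0) q → length P ≢ n
    no-divergence n p steps b e with P₂ , e₂ , b₂ ← silent-step b (steps 0)
      with n | trans (sym e) e₂
    ... | suc n | e₃ = no-divergence n (p ∘ suc) (steps ∘ suc) b₂ (sym (suc-injective e₃))

    coordinated-bisimilar : coordinated ≈ᵇˢᵀᵇΔ N
    coordinated-bisimilar = Bisimilar , record
      { isBranchingBisimulation = record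
        { initial  = [] , record
          { past     = []
          ; running  = []
          ; logging  = logging-init
          ; threads′ = refl
          ; threads  = refl
          ; balance  = λ _ → refl
          }
        ; forward  = forward
        ; backward = backward
        }
      -- Neither net has an infinite silent sequence through related states, so both clauses hold
      -- vacuously.
      ; forward-divergence  = λ p steps b → contradiction refl (no-divergence _ p steps (proj₂ (b 0)))
      ; backward-divergence = λ p steps b → contradiction (proj₁ (proj₂ (proj₁ (steps 0)))) (visible _)
      }

corollary3 : ExcludedMiddle 0ℓ →
    ∀ {r : Level} {Act : Set} (_≈_ : Rel (PetriNet Act) r) →
    IsEquivalence _≈_ →
    (∀ N₁ N₂ → N₁ ≈ᵇˢᵀᵇΔ N₂ → N₁ ≈ N₂) →
    (∀ N₁ N₂ → N₁ ≈ N₂ → N₁ ≈ᴿ N₂) →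
    ∀ (N : PetriNet Act) →
    IsFinitary N → IsPlain N → IsStructuralConflictNet N →
    DistributableUpTo _≈_ N ⇔ (¬ HasFullyReachablePureM N)
corollary3 em _≈_ _ finer coarser N finitary plain scn = mk⇔
  (λ (N′ , dist , N′≈N) → distributable⇒no-M em N N′ dist (coarser N′ N N′≈N) plain scn)
  (λ noM → _ , C.coordinated-distributed noM ,
    finer _ N (C.coordinated-bisimilar noM (proj₂ plain)))
  where
  module C = Coordination em N finitary scn
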